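{- Let $k$ and $i$ be integers with $1\le i\le k/2$, $k\equiv 0\pmod 4$ and $i\equiv 0\pmod 4$. Then for all integers $n\ge 0$, $$S_{k,i}(4n+2)\equiv S_{k,i}(4n+3)\equiv 0\pmod 4.$$
   Context: Write $(a;q)_\infty=\prod_{m\ge 0}(1-aq^m)$, $(a)_\infty=(a;q)_\infty$, and $(a_1,\ldots,a_r;q)_\infty=(a_1;q)_\infty\cdots(a_r;q)_\infty$. For integers $k,i$ with $1\le i\le k/2$, the integers $S_{k,i}(n)$, $n\ge 0$, are given by the generating function $$\sum_{n\ge 0}S_{k,i}(n)q^n=\frac{(-q)_\infty\,(q^i,q^{k-i},q^k;q^k)_\infty}{(q)_\infty}.$$ Combinatorially (an overpartition of $n$ is a partition of $n$ in which the first occurrence of each integer may be overlined): if $i<k/2$, $S_{k,i}(n)$ is the number of overpartitions of $n$ whose non-overlined parts are not congruent to $0,\pm i$ modulo $k$; if $i=k/2$, it is the number of overpartitions of $n$ with no part divisible by $k/2$. -}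

module Defs where

open import Algebra.Bundles.Raw using (RawRing)
open import Data.Fin.Base using (toℕ)
open import Data.Integer.Base as ℤ using (ℤ; 0ℤ; 1ℤ)
open import Data.Nat.Base as ℕ using (ℕ; suc; _∸_)
open import Level using (0ℓ)
open import Relation.Binary.PropositionalEquality.Core using (_≗_)

import Algebra.Definitions.RawSemiring as SemiringOps

open SemiringOps ℤ.+-*-rawSemiring using (sum)

-- Formal power series over ℤ, represented by their coefficients:
-- f stands for Σ_{n≥0} (f n) qⁿ.
Series : Set
Series = ℕ → ℤ

0ₛ 1ₛ q : Series
0ₛ _ = 0ℤ

1ₛ 0       = 1ℤ
1ₛ (suc _) = 0ℤ

q 0             = 0ℤ
q 1             = 1ℤ
q (suc (suc _)) = 0ℤ

infix  8 -_
infixl 7 _*_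
infixl 6 _+_ _-_

_+_ _-_ _*_ : Series → Series → Series
(f + g) n = f n ℤ.+ g n
(f - g) n = f n ℤ.- g n
(f * g) n = sum {n = suc n} (λ j → f (toℕ j) ℤ.* g (n ∸ toℕ j))

-_ : Series → Series
(- f) n = ℤ.- f n

seriesRawRing : RawRing 0ℓ 0ℓ
seriesRawRing = record
  { Carrier = Series
  ; _≈_     = _≗_
  ; _+_     = _+_
  ; _*_     = _*_
  ; -_      = -_
  ; 0#      = 0ₛ
  ; 1#      = 1ₛ
  }

open SemiringOps (RawRing.rawSemiring seriesRawRing) public
  using (_^_; product)
  renaming (sum to sumₛ)

-- The inverse 1/f = Σ_{m≥0} (1 - f)ᵐ of a series f with constant term 1.
-- Since qᵐ divides (1 - f)ᵐ, only the terms m ≤ n contribute to the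
-- coefficient of qⁿ.
infix 9 _⁻¹
_⁻¹ : Series → Series
(f ⁻¹) n = sumₛ {n = suc n} (λ m → (1ₛ - f) ^ toℕ m) n

-- (a ; b)∞ = ∏_{m≥0} (1 - a bᵐ) for a series b with constant term 0.
-- Since qᵐ divides a bᵐ, only the factors m ≤ n contribute to the
-- coefficient of qⁿ.
⟨_⨾_⟩∞ : Series → Series → Series
⟨ a ⨾ b ⟩∞ n = product {n = suc n} (λ m → 1ₛ - a * b ^ toℕ m) n

-- S k i n is the coefficient of qⁿ in
--   (-q; q)∞ (qⁱ, qᵏ⁻ⁱ, qᵏ; qᵏ)∞ / (q; q)∞,
-- which is meaningful for 1 ≤ i and 2i ≤ k (truncated subtraction k ∸ i is
-- then the true one, and qᵏ has constant term 0).
S : ℕ → ℕ → Series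
S k i =
  ⟨ - q ⨾ q ⟩∞
    * (⟨ q ^ i ⨾ q ^ k ⟩∞ * ⟨ q ^ (k ∸ i) ⨾ q ^ k ⟩∞ * ⟨ q ^ k ⨾ q ^ k ⟩∞)
    * ⟨ q ⨾ q ⟩∞ ⁻¹

{-# OPTIONS --safe #-}

-- Write (-q)∞/(q)∞ = ∏ (1 + qᵐ)/(1 - qᵐ) = ∏ (1 + 2 Lₘ) with Lₘ = Σ_{b≥1} qᵐᵇ.
-- Modulo 4 this is 1 + 2 Σ_{a,b≥1} qᵃᵇ, and the terms with a ≠ b cancel in
-- pairs, which leaves 1 + 2 Σ_{a≥1} q^(a²), with all exponents 0 or 1 modulo 4.
-- The remaining factor of the generating function is a series in q⁴.
module Submission where

open import Algebra.Bundles using (CommutativeRing; CommutativeSemiring; Monoid)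

-- Finite sums in a monoid.

module _ {c ℓ} (M : Monoid c ℓ) where

  open import Data.Fin.Base using (toℕ)
  open import Data.Nat.Base using (ℕ; zero; suc)
  open import Function.Base using (_∘_)
  open Monoid M
  open import Algebra.Properties.Monoid.Sum M using (sum)

  -- `sum` unfolds at the front, while partial sums and products grow at the back. In a
  -- multiplicative monoid the same statement is about products.
  sum-snoc : ∀ (f : ℕ → Carrier) n →
             sum {suc n} (f ∘ toℕ) ≈ sum {n} (f ∘ toℕ) ∙ f n
  sum-snoc f zero    = trans (identityʳ _) (sym (identityˡ _))
  sum-snoc f (suc n) = trans (∙-congˡ (sum-snoc (f ∘ suc) n)) (sym (assoc _ _ _))

-- Identities in commutative semirings, first in general and then with 4 = 0.

module SemiringIdentities {c ℓ} (R : CommutativeSemiring c ℓ) where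

  open import Data.Fin.Base using (toℕ; zero; suc)
  open import Data.Nat.Base using (ℕ; zero; suc)
  open import Data.Vec.Functional using (Vector)
  open import Function.Base using (_∘_)
  open CommutativeSemiring R hiding (zero)
  open import Algebra.Definitions.RawSemiring rawSemiring using (_^_; product)
  open import Algebra.Properties.Semiring.Sum semiring
    using (sum; *-distribˡ-sum; sum-cong-≋; ∑-distrib-+)
  open import Algebra.Solver.Ring.NaturalCoefficients.Default R
    using (solve; _:=_; _:+_; _:*_; con)
  open import Relation.Binary.Reasoning.Setoid setoid

  -- With `y` in the role of 1 - x, this is the subtraction-free form of (1 - x)(1 + x + ... +
  -- x^(n-1)) = 1 - x^n.
  geometric-sum : ∀ {x y} → y + x ≈ 1# → ∀ n →
                  y * sum {n} (λ b → x ^ toℕ b) + x ^ n ≈ 1#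
  geometric-sum y+x≈1 zero = trans (+-congʳ (zeroʳ _)) (+-identityˡ 1#)
  geometric-sum {x} {y} y+x≈1 (suc n) = begin
    y * (1# + sum {n} (λ b → x * x ^ toℕ b)) + x * x ^ n
      ≈⟨ +-congʳ (*-congˡ (+-congˡ (*-distribˡ-sum {n} x (λ b → x ^ toℕ b)))) ⟨
    y * (1# + x * G) + x * x ^ n
      ≈⟨ solve 4 (λ x y g p → y :* (con 1 :+ x :* g) :+ x :* p
                            := y :+ x :* (y :* g :+ p)) refl x y G (x ^ n) ⟩
    y + x * (y * G + x ^ n)  ≈⟨ +-congˡ (*-congˡ (geometric-sum y+x≈1 n)) ⟩
    y + x * 1#               ≈⟨ +-congˡ (*-identityʳ x) ⟩
    y + x                    ≈⟨ y+x≈1 ⟩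
    1#                       ∎
    where G = sum {n} (λ b → x ^ toℕ b)

  -- Meant for `a` = (-q)∞, `b` = (q)∞, `i` the inverse of `b`, and `g` the product (q^i, q^(k-i),
  -- q^k; q^k)∞.
  cancel-inverse : ∀ {a b i t} → a ≈ b * t → b * i ≈ 1# → ∀ g → a * g * i ≈ g * t
  cancel-inverse {a} {b} {i} {t} a≈bt bi≈1 g = begin
    a * g * i          ≈⟨ *-congʳ (*-congʳ a≈bt) ⟩
    b * t * g * i      ≈⟨ solve 4 (λ b t g i → b :* t :* g :* i := (g :* t) :* (b :* i))
                                  refl b t g i ⟩
    (g * t) * (b * i)  ≈⟨ *-congˡ bi≈1 ⟩
    (g * t) * 1#       ≈⟨ *-identityʳ (g * t) ⟩
    g * t              ∎

  -- With `y` = 1 - x and `g` its inverse, this is (1 + x)/(1 - x) = 1 + 2x/(1 - x), multiplied by 1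
  -- - x.
  1+x≈y*[1+2*x*g] : ∀ {x y g} → y + x ≈ 1# → y * g ≈ 1# →
                 1# + x ≈ y * (1# + (x * g + x * g))
  1+x≈y*[1+2*x*g] {x} {y} {g} y+x≈1 y*g≈1 = begin
    1# + x                         ≈⟨ +-congʳ y+x≈1 ⟨
    (y + x) + x                    ≈⟨ solve 2 (λ x y → (y :+ x) :+ x := y :+ (x :+ x) :* con 1)
                                              refl x y ⟩
    y + (x + x) * 1#               ≈⟨ +-congˡ (*-congˡ y*g≈1) ⟨
    y + (x + x) * (y * g)          ≈⟨ solve 3 (λ x y g → y :+ (x :+ x) :* (y :* g)
                                        := y :* (con 1 :+ (x :* g :+ x :* g))) refl x y g ⟩
    y * (1# + (x * g + x * g))     ∎

  module _ (4≈0 : ∀ x → (x + x) + (x + x) ≈ 0#) where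

    -- In (1 + 2x)(1 + 2s) the cross term is 4xs, which vanishes, so such factors multiply by adding
    -- their halves.
    product-1+2x : ∀ {n} (f : Vector Carrier n) →
                   product (λ a → 1# + (f a + f a)) ≈ 1# + (sum f + sum f)
    product-1+2x {zero}  f = sym (trans (+-congˡ (+-identityˡ 0#)) (+-identityʳ 1#))
    product-1+2x {suc n} f = begin
      (1# + (x + x)) * product (λ a → 1# + (f (suc a) + f (suc a)))
        ≈⟨ *-congˡ (product-1+2x (f ∘ suc)) ⟩
      (1# + (x + x)) * (1# + (s + s))
        ≈⟨ solve 2 (λ x s → (con 1 :+ (x :+ x)) :* (con 1 :+ (s :+ s))
             := (con 1 :+ ((x :+ s) :+ (x :+ s)))
                  :+ ((x :* s :+ x :* s) :+ (x :* s :+ x :* s))) refl x s ⟩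
      (1# + ((x + s) + (x + s))) + ((x * s + x * s) + (x * s + x * s))
        ≈⟨ +-congˡ (4≈0 (x * s)) ⟩
      (1# + ((x + s) + (x + s))) + 0#
        ≈⟨ +-identityʳ _ ⟩
      1# + ((x + s) + (x + s)) ∎
      where
      x = f zero
      s = sum (f ∘ suc)

    -- Off the diagonal, `F a b` and `F b a` are equal, so after doubling each value occurs four
    -- times and cancels. The induction strips the first row and the first column.
    2*symmetric-sum : (F : ℕ → ℕ → Carrier) → (∀ a b → F a b ≈ F b a) → ∀ n →
      let D = sum {n} (λ a → sum {n} (λ b → F (toℕ a) (toℕ b)))
          E = sum {n} (λ a → F (toℕ a) (toℕ a))
      in D + D ≈ E + E
    2*symmetric-sum F F-sym zero    = refl
    2*symmetric-sum F F-sym (suc n) = begin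
      ((z + r) + rest) + ((z + r) + rest)
        ≈⟨ +-cong (+-congˡ rest≈) (+-congˡ rest≈) ⟩
      ((z + r) + (r + D)) + ((z + r) + (r + D))
        ≈⟨ solve 3 (λ z r d → ((z :+ r) :+ (r :+ d)) :+ ((z :+ r) :+ (r :+ d))
             := ((z :+ z) :+ (d :+ d)) :+ ((r :+ r) :+ (r :+ r))) refl z r D ⟩
      ((z + z) + (D + D)) + ((r + r) + (r + r))
        ≈⟨ +-congˡ (4≈0 r) ⟩
      ((z + z) + (D + D)) + 0#
        ≈⟨ +-identityʳ _ ⟩
      (z + z) + (D + D)
        ≈⟨ +-congˡ (2*symmetric-sum (λ a b → F (suc a) (suc b))
                                    (λ a b → F-sym (suc a) (suc b)) n) ⟩
      (z + z) + (E + E)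
        ≈⟨ solve 2 (λ z e → (z :+ z) :+ (e :+ e) := (z :+ e) :+ (z :+ e)) refl z E ⟩
      (z + E) + (z + E) ∎
      where
      z = F 0 0
      r = sum {n} (λ b → F 0 (suc (toℕ b)))
      D = sum {n} (λ a → sum {n} (λ b → F (suc (toℕ a)) (suc (toℕ b))))
      E = sum {n} (λ a → F (suc (toℕ a)) (suc (toℕ a)))
      rest = sum {n} (λ a → sum {suc n} (λ b → F (suc (toℕ a)) (toℕ b)))
      -- By symmetry the stripped column has the same sum `r` as the stripped row, which yields 4r
      -- in total.
      rest≈ : rest ≈ r + D
      rest≈ = trans
        (∑-distrib-+ {n} (λ a → F (suc (toℕ a)) 0)
                         (λ a → sum {n} (λ b → F (suc (toℕ a)) (suc (toℕ b)))))
        (+-congʳ (sum-cong-≋ {n} (λ a → F-sym (suc (toℕ a)) 0)))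

module PowerSeries where

  open import Defs
  open import Data.Fin.Base using (Fin; toℕ; zero; suc)
  open import Data.Integer.Base as ℤ using (ℤ; 0ℤ; 1ℤ; +_)
  open import Data.Integer.Divisibility.Signed as ℤ using (divides)
  import Data.Integer.Properties as ℤ
  import Data.Integer.Tactic.RingSolver as ℤSolver
  open import Data.Nat.Base as ℕ
    using (ℕ; zero; suc; _≤_; _<_; _∸_; z≤n; s≤s; _%_; _≤′_; ≤′-refl; ≤′-step)
  open import Data.Nat.Divisibility as ℕ using () renaming (_∣_ to _∣ₙ_)
  open import Data.Nat.DivMod using (%-distribˡ-*; m%n<n; [m+kn]%n≡m%n)
  import Data.Nat.Properties as ℕ
  open import Data.Product.Base using (_,_)
  open import Data.Sum.Base as Sum using (_⊎_; inj₁; inj₂)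
  open import Function.Base using (_∘_; id)
  open import Level using (0ℓ)
  open import Relation.Binary.Definitions using (Symmetric; Transitive)
  open import Relation.Binary.PropositionalEquality
    using (_≡_; _≗_; refl; sym; trans; cong; cong₂; subst; module ≡-Reasoning)
  open import Relation.Nullary.Negation using (contradiction)

  -- The Cauchy product

  -- By definition `(f * g) (suc n)` reduces to `f 0 ℤ.* g (suc n) ℤ.+ ((f ∘ suc) * g) n`. The laws
  -- of the product follow by induction along this recursion, which shifts the left factor.
  *-cong-≗ : ∀ {f f′ g g′} → f ≗ f′ → g ≗ g′ → f * g ≗ f′ * g′
  *-cong-≗ f≗ g≗ zero    = cong₂ ℤ._+_ (cong₂ ℤ._*_ (f≗ 0) (g≗ 0)) refl
  *-cong-≗ f≗ g≗ (suc n) =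
    cong₂ ℤ._+_ (cong₂ ℤ._*_ (f≗ 0) (g≗ (suc n))) (*-cong-≗ (f≗ ∘ suc) g≗ n)

  -- The recursion peels only the left factor. So one term of `f` is peeled, the factors are
  -- exchanged, one term of `g` is peeled, and the rest is exchanged back. This uses the two
  -- preceding indices, hence two base cases.
  *-comm-≗ : ∀ f g → f * g ≗ g * f
  *-comm-≗ f g 0 = cong (ℤ._+ 0ℤ) (ℤ.*-comm (f 0) (g 0))
  *-comm-≗ f g 1 = swap (f 0) (f 1) (g 0) (g 1)
    where
    swap : ∀ a b c d → a ℤ.* d ℤ.+ (b ℤ.* c ℤ.+ 0ℤ) ≡ c ℤ.* b ℤ.+ (d ℤ.* a ℤ.+ 0ℤ)
    swap = ℤSolver.solve-∀
  *-comm-≗ f g (suc (suc n)) = begin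
    f 0 ℤ.* g (2 ℕ.+ n) ℤ.+ ((f ∘ suc) * g) (suc n)
      ≡⟨ cong (λ s → f 0 ℤ.* g (2 ℕ.+ n) ℤ.+ s) (*-comm-≗ (f ∘ suc) g (suc n)) ⟩
    f 0 ℤ.* g (2 ℕ.+ n) ℤ.+ (g 0 ℤ.* f (2 ℕ.+ n) ℤ.+ ((g ∘ suc) * (f ∘ suc)) n)
      ≡⟨ cong (λ s → f 0 ℤ.* g (2 ℕ.+ n) ℤ.+ (g 0 ℤ.* f (2 ℕ.+ n) ℤ.+ s))
              (*-comm-≗ (g ∘ suc) (f ∘ suc) n) ⟩
    f 0 ℤ.* g (2 ℕ.+ n) ℤ.+ (g 0 ℤ.* f (2 ℕ.+ n) ℤ.+ ((f ∘ suc) * (g ∘ suc)) n)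
      ≡⟨ swap (f 0 ℤ.* g (2 ℕ.+ n)) (g 0 ℤ.* f (2 ℕ.+ n)) _ ⟩
    g 0 ℤ.* f (2 ℕ.+ n) ℤ.+ (f 0 ℤ.* g (2 ℕ.+ n) ℤ.+ ((f ∘ suc) * (g ∘ suc)) n)
      ≡⟨ cong (λ s → g 0 ℤ.* f (2 ℕ.+ n) ℤ.+ s) (*-comm-≗ (g ∘ suc) f (suc n)) ⟨
    g 0 ℤ.* f (2 ℕ.+ n) ℤ.+ ((g ∘ suc) * f) (suc n) ∎
    where
    open ≡-Reasoning
    swap : ∀ a b c → a ℤ.+ (b ℤ.+ c) ≡ b ℤ.+ (a ℤ.+ c)
    swap = ℤSolver.solve-∀

  *-distribʳ-≗ : ∀ h f g → (f + g) * h ≗ f * h + g * h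
  *-distribʳ-≗ h f g zero = distrib (f 0) (g 0) (h 0)
    where
    distrib : ∀ a b c → (a ℤ.+ b) ℤ.* c ℤ.+ 0ℤ ≡ (a ℤ.* c ℤ.+ 0ℤ) ℤ.+ (b ℤ.* c ℤ.+ 0ℤ)
    distrib = ℤSolver.solve-∀
  *-distribʳ-≗ h f g (suc n) = trans
    (cong (λ s → (f 0 ℤ.+ g 0) ℤ.* h (suc n) ℤ.+ s) (*-distribʳ-≗ h (f ∘ suc) (g ∘ suc) n))
    (distrib (f 0) (g 0) (h (suc n)) _ _)
    where
    distrib : ∀ a b c s t →
      (a ℤ.+ b) ℤ.* c ℤ.+ (s ℤ.+ t) ≡ (a ℤ.* c ℤ.+ s) ℤ.+ (b ℤ.* c ℤ.+ t)
    distrib = ℤSolver.solve-∀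

  *-scaleˡ : ∀ c f g n → ((λ j → c ℤ.* f j) * g) n ≡ c ℤ.* (f * g) n
  *-scaleˡ c f g zero = scale c (f 0) (g 0)
    where
    scale : ∀ c a b → c ℤ.* a ℤ.* b ℤ.+ 0ℤ ≡ c ℤ.* (a ℤ.* b ℤ.+ 0ℤ)
    scale = ℤSolver.solve-∀
  *-scaleˡ c f g (suc n) = trans
    (cong (λ s → c ℤ.* f 0 ℤ.* g (suc n) ℤ.+ s) (*-scaleˡ c (f ∘ suc) g n))
    (scale c (f 0) (g (suc n)) _)
    where
    scale : ∀ c a b s → c ℤ.* a ℤ.* b ℤ.+ c ℤ.* s ≡ c ℤ.* (a ℤ.* b ℤ.+ s)
    scale = ℤSolver.solve-∀

  -- The shift of `f * g` is `(λ j → f 0 ℤ.* g (suc j)) + (f ∘ suc) *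
  -- g`; right distributivity and `*-scaleˡ` treat its two summands.
  *-assoc-≗ : ∀ f g h → (f * g) * h ≗ f * (g * h)
  *-assoc-≗ f g h zero = assoc (f 0) (g 0) (h 0)
    where
    assoc : ∀ a b c → (a ℤ.* b ℤ.+ 0ℤ) ℤ.* c ℤ.+ 0ℤ ≡ a ℤ.* (b ℤ.* c ℤ.+ 0ℤ) ℤ.+ 0ℤ
    assoc = ℤSolver.solve-∀
  *-assoc-≗ f g h (suc n) = begin
    (f * g) 0 ℤ.* h (suc n) ℤ.+ (((λ j → f 0 ℤ.* g (suc j)) + (f ∘ suc) * g) * h) n
      ≡⟨ cong (λ s → (f * g) 0 ℤ.* h (suc n) ℤ.+ s) (begin
        (((λ j → f 0 ℤ.* g (suc j)) + (f ∘ suc) * g) * h) n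
          ≡⟨ *-distribʳ-≗ h (λ j → f 0 ℤ.* g (suc j)) ((f ∘ suc) * g) n ⟩
        ((λ j → f 0 ℤ.* g (suc j)) * h) n ℤ.+ ((f ∘ suc) * g * h) n
          ≡⟨ cong₂ ℤ._+_ (*-scaleˡ (f 0) (g ∘ suc) h n) (*-assoc-≗ (f ∘ suc) g h n) ⟩
        f 0 ℤ.* ((g ∘ suc) * h) n ℤ.+ ((f ∘ suc) * (g * h)) n ∎) ⟩
    (f 0 ℤ.* g 0 ℤ.+ 0ℤ) ℤ.* h (suc n)
      ℤ.+ (f 0 ℤ.* ((g ∘ suc) * h) n ℤ.+ ((f ∘ suc) * (g * h)) n)
      ≡⟨ regroup (f 0) (g 0) (h (suc n)) _ _ ⟩
    f 0 ℤ.* (g 0 ℤ.* h (suc n) ℤ.+ ((g ∘ suc) * h) n) ℤ.+ ((f ∘ suc) * (g * h)) n ∎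
    where
    open ≡-Reasoning
    regroup : ∀ a b c s t →
      (a ℤ.* b ℤ.+ 0ℤ) ℤ.* c ℤ.+ (a ℤ.* s ℤ.+ t) ≡ a ℤ.* (b ℤ.* c ℤ.+ s) ℤ.+ t
    regroup = ℤSolver.solve-∀

  *-zeroˡ-≗ : ∀ g → 0ₛ * g ≗ 0ₛ
  *-zeroˡ-≗ g zero    = refl
  *-zeroˡ-≗ g (suc n) = trans (ℤ.+-identityˡ _) (*-zeroˡ-≗ g n)

  *-identityˡ-≗ : ∀ g → 1ₛ * g ≗ g
  *-identityˡ-≗ g zero    = trans (ℤ.+-identityʳ _) (ℤ.*-identityˡ (g 0))
  *-identityˡ-≗ g (suc n) = trans
    (cong₂ ℤ._+_ (ℤ.*-identityˡ (g (suc n))) (*-zeroˡ-≗ g n)) (ℤ.+-identityʳ _)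

  -- Congruence of series modulo 4 and q^N

  infix 4 _≡₄_ _≈[_]_

  -- This and _≈[_]_ are records so that their sides can be inferred from a proof.
  record _≡₄_ (x y : ℤ) : Set where
    constructor congruent
    field 4∣difference : (+ 4) ℤ.∣ x ℤ.- y

  open _≡₄_

  ≡₄-reflexive : ∀ {x y} → x ≡ y → x ≡₄ y
  ≡₄-reflexive {x} refl .4∣difference = divides 0ℤ (ℤ.+-inverseʳ x)

  ≡₄-sym : Symmetric _≡₄_
  ≡₄-sym {x} {y} (congruent p) .4∣difference =
    subst ((+ 4) ℤ.∣_) (eq x y) (ℤ.∣m⇒∣-m p)
    where
    eq : ∀ x y → ℤ.- (x ℤ.- y) ≡ y ℤ.- x
    eq = ℤSolver.solve-∀

  ≡₄-trans : Transitive _≡₄_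
  ≡₄-trans {x} {y} {z} (congruent p) (congruent r) .4∣difference =
    subst ((+ 4) ℤ.∣_) (eq x y z) (ℤ.∣m∣n⇒∣m+n p r)
    where
    eq : ∀ x y z → (x ℤ.- y) ℤ.+ (y ℤ.- z) ≡ x ℤ.- z
    eq = ℤSolver.solve-∀

  +-cong-≡₄ : ∀ {x x′ y y′} → x ≡₄ x′ → y ≡₄ y′ → x ℤ.+ y ≡₄ x′ ℤ.+ y′
  +-cong-≡₄ {x} {x′} {y} {y′} (congruent p) (congruent r) .4∣difference =
    subst ((+ 4) ℤ.∣_) (eq x x′ y y′) (ℤ.∣m∣n⇒∣m+n p r)
    where
    eq : ∀ x x′ y y′ → (x ℤ.- x′) ℤ.+ (y ℤ.- y′) ≡ (x ℤ.+ y) ℤ.- (x′ ℤ.+ y′)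
    eq = ℤSolver.solve-∀

  *-cong-≡₄ : ∀ {x x′ y y′} → x ≡₄ x′ → y ≡₄ y′ → x ℤ.* y ≡₄ x′ ℤ.* y′
  *-cong-≡₄ {x} {x′} {y} {y′} (congruent p) (congruent r) .4∣difference =
    subst ((+ 4) ℤ.∣_) (eq x x′ y y′) (ℤ.∣m∣n⇒∣m+n (ℤ.∣m⇒∣m*n y p) (ℤ.∣n⇒∣m*n x′ r))
    where
    eq : ∀ x x′ y y′ →
      (x ℤ.- x′) ℤ.* y ℤ.+ x′ ℤ.* (y ℤ.- y′) ≡ x ℤ.* y ℤ.- x′ ℤ.* y′
    eq = ℤSolver.solve-∀

  neg-cong-≡₄ : ∀ {x x′} → x ≡₄ x′ → ℤ.- x ≡₄ ℤ.- x′
  neg-cong-≡₄ {x} {x′} (congruent p) .4∣difference =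
    subst ((+ 4) ℤ.∣_) (eq x x′) (ℤ.∣m⇒∣-m p)
    where
    eq : ∀ x x′ → ℤ.- (x ℤ.- x′) ≡ ℤ.- x ℤ.- ℤ.- x′
    eq = ℤSolver.solve-∀

  record _≈[_]_ (f : Series) (N : ℕ) (g : Series) : Set where
    constructor coefficientwise
    field at : ∀ j → j < N → f j ≡₄ g j

  open _≈[_]_

  ≗⇒≈ : ∀ {N f g} → f ≗ g → f ≈[ N ] g
  ≗⇒≈ f≗g .at j _ = ≡₄-reflexive (f≗g j)

  -- Coefficient `j` of a Cauchy product involves only indices up to `j`.
  *-cong-≈ : ∀ {N f f′ g g′} → f ≈[ N ] f′ → g ≈[ N ] g′ → f * g ≈[ N ] f′ * g′
  *-cong-≈ f≈ g≈ .at zero 0<N =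
    +-cong-≡₄ (*-cong-≡₄ (f≈ .at 0 0<N) (g≈ .at 0 0<N)) (≡₄-reflexive {0ℤ} refl)
  *-cong-≈ {suc N} f≈ g≈ .at (suc j) 1+j<1+N@(s≤s j<N) = +-cong-≡₄
    (*-cong-≡₄ (f≈ .at 0 (s≤s z≤n)) (g≈ .at (suc j) 1+j<1+N))
    -- Shifting `f` costs one known coefficient, so the precision drops from `suc N` to `N` along
    -- with the index.
    (*-cong-≈ {N} (coefficientwise λ i i<N → f≈ .at (suc i) (s≤s i<N))
                  (coefficientwise λ i i<N → g≈ .at i (ℕ.m<n⇒m<1+n i<N)) .at j j<N)

  -- This is ℤ[[q]]/(4, q^N), with the quotient carried by the equality. In it infinite products
  -- become finite, so the semiring identities apply.
  truncatedRing : ℕ → CommutativeRing 0ℓ 0ℓ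
  truncatedRing N = record
    { Carrier = Series ; _≈_ = _≈[ N ]_
    ; _+_ = _+_ ; _*_ = _*_ ; -_ = -_ ; 0# = 0ₛ ; 1# = 1ₛ
    ; isCommutativeRing = record
      { isRing = record
        { +-isAbelianGroup = record
          { isGroup = record
            { isMonoid = record
              { isSemigroup = record
                { isMagma = record
                  { isEquivalence = record
                    { refl  = ≗⇒≈ (λ _ → refl)
                    ; sym   = λ f≈g → coefficientwise λ j j<N → ≡₄-sym (f≈g .at j j<N)
                    ; trans = λ f≈g g≈h → coefficientwise λ j j<N →
                              ≡₄-trans (f≈g .at j j<N) (g≈h .at j j<N)
                    }
                  ; ∙-cong = λ f≈ g≈ → coefficientwise λ j j<N →
                             +-cong-≡₄ (f≈ .at j j<N) (g≈ .at j j<N)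
                  }
                ; assoc = λ f g h → ≗⇒≈ (λ j → ℤ.+-assoc (f j) (g j) (h j))
                }
              ; identity = (λ f → ≗⇒≈ (λ j → ℤ.+-identityˡ (f j)))
                         , (λ f → ≗⇒≈ (λ j → ℤ.+-identityʳ (f j)))
              }
            ; inverse = (λ f → ≗⇒≈ (λ j → ℤ.+-inverseˡ (f j)))
                      , (λ f → ≗⇒≈ (λ j → ℤ.+-inverseʳ (f j)))
            ; ⁻¹-cong = λ f≈ → coefficientwise λ j j<N → neg-cong-≡₄ (f≈ .at j j<N)
            }
          ; comm = λ f g → ≗⇒≈ (λ j → ℤ.+-comm (f j) (g j))
          }
        ; *-cong = *-cong-≈
        ; *-assoc = λ f g h → ≗⇒≈ (*-assoc-≗ f g h)
        ; *-identity = (λ f → ≗⇒≈ (*-identityˡ-≗ f))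
                     , (λ f → ≗⇒≈ (λ j → trans (*-comm-≗ f 1ₛ j) (*-identityˡ-≗ f j)))
        ; distrib = (λ f g h → ≗⇒≈ (λ j → trans (*-comm-≗ f (g + h) j)
                      (trans (*-distribʳ-≗ f g h j)
                             (cong₂ ℤ._+_ (*-comm-≗ g f j) (*-comm-≗ h f j)))))
                  , (λ f g h → ≗⇒≈ (*-distribʳ-≗ f g h))
        }
      ; *-comm = λ f g → ≗⇒≈ (*-comm-≗ f g)
      }
    }

  4≈0 : ∀ {N} f → (f + f) + (f + f) ≈[ N ] 0ₛ
  4≈0 f .at j _ .4∣difference = divides (f j) (eq (f j))
    where
    eq : ∀ x → ((x ℤ.+ x) ℤ.+ (x ℤ.+ x)) ℤ.- 0ℤ ≡ x ℤ.* (+ 4)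
    eq = ℤSolver.solve-∀

  module _ {N : ℕ} where

    private
      module R = CommutativeRing (truncatedRing N)

    open import Algebra.Properties.Semiring.Exp R.semiring
      using (^-assocʳ) renaming (_^_ to _^ᴿ_)

    -- The two powers come from raw semirings with different equality fields,
    -- so they agree by induction only.
    ^≡^ᴿ : ∀ f m → f ^ m ≡ f ^ᴿ m
    ^≡^ᴿ f zero    = refl
    ^≡^ᴿ f (suc m) = cong (f *_) (^≡^ᴿ f m)

    ^-assoc-≈ : ∀ f m n → (f ^ m) ^ n ≈[ N ] f ^ (m ℕ.* n)
    ^-assoc-≈ f m n = begin
      (f ^ m) ^ n     ≡⟨ ^≡^ᴿ (f ^ m) n ⟩
      (f ^ m) ^ᴿ n    ≡⟨ cong (_^ᴿ n) (^≡^ᴿ f m) ⟩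
      (f ^ᴿ m) ^ᴿ n   ≈⟨ ^-assocʳ f m n ⟩
      f ^ᴿ (m ℕ.* n)  ≡⟨ ^≡^ᴿ f (m ℕ.* n) ⟨
      f ^ (m ℕ.* n)   ∎
      where open import Relation.Binary.Reasoning.Setoid R.setoid

  -- Supports

  -- The disjunction allows case analysis at each index without a decision procedure for `P`.
  -- Vanishing is exact in ℤ, not merely modulo 4.
  SupportedIn : (ℕ → Set) → Series → Set
  SupportedIn P f = ∀ n → P n ⊎ f n ≡ 0ℤ

  weaken : ∀ {P Q f} → (∀ {n} → P n → Q n) → SupportedIn P f → SupportedIn Q f
  weaken P⊆Q sf n = Sum.map₁ P⊆Q (sf n)

  0ₛ-supported : ∀ {P} → SupportedIn P 0ₛ
  0ₛ-supported n = inj₂ refl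

  1ₛ-supported : SupportedIn (_≡ 0) 1ₛ
  1ₛ-supported zero    = inj₁ refl
  1ₛ-supported (suc n) = inj₂ refl

  +-supported : ∀ {P f g} → SupportedIn P f → SupportedIn P g → SupportedIn P (f + g)
  +-supported sf sg n with sf n | sg n
  ... | inj₁ p  | _       = inj₁ p
  ... | inj₂ _  | inj₁ p  = inj₁ p
  ... | inj₂ f0 | inj₂ g0 = inj₂ (cong₂ ℤ._+_ f0 g0)

  neg-supported : ∀ {P f} → SupportedIn P f → SupportedIn P (- f)
  neg-supported sf n = Sum.map₂ (cong (λ x → ℤ.- x)) (sf n)

  -- Exponents add under multiplication. Three separate predicates keep the induction going:
  -- shifting `f` shifts `P` and `R` but leaves `Q` fixed.
  *-supported : ∀ {P Q R f g} → (∀ {a b} → P a → Q b → R (a ℕ.+ b)) →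
                SupportedIn P f → SupportedIn Q g → SupportedIn R (f * g)
  *-supported {f = f} {g} P+Q⊆R sf sg zero with sf 0 | sg 0
  ... | inj₁ p  | inj₁ r  = inj₁ (P+Q⊆R p r)
  ... | inj₂ f0 | _       = inj₂ (trans (ℤ.+-identityʳ _) (cong (ℤ._* g 0) f0))
  ... | inj₁ _  | inj₂ g0 = inj₂ (trans (ℤ.+-identityʳ _)
                              (trans (cong (f 0 ℤ.*_) g0) (ℤ.*-zeroʳ (f 0))))
  *-supported {R = R} {f} {g} P+Q⊆R sf sg (suc n)
    with *-supported {R = R ∘ suc} {f ∘ suc} P+Q⊆R (sf ∘ suc) sg n | sf 0 | sg (suc n)
  ... | inj₁ p  | _       | _       = inj₁ p
  ... | inj₂ _  | inj₁ p  | inj₁ r  = inj₁ (P+Q⊆R p r)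
  ... | inj₂ s0 | inj₂ f0 | _       = inj₂ (cong₂ ℤ._+_ (cong (ℤ._* g (suc n)) f0) s0)
  ... | inj₂ s0 | inj₁ _  | inj₂ g0 = inj₂ (cong₂ ℤ._+_
                                (trans (cong (f 0 ℤ.*_) g0) (ℤ.*-zeroʳ (f 0))) s0)

  sum-supported : ∀ {P n} {f : Fin n → Series} →
                  (∀ a → SupportedIn P (f a)) → SupportedIn P (sumₛ f)
  sum-supported {n = zero}  sf = 0ₛ-supported
  sum-supported {n = suc n} sf = +-supported (sf zero) (sum-supported (sf ∘ suc))

  ^-supported-≥ : ∀ {f} → SupportedIn (1 ≤_) f → ∀ m → SupportedIn (m ≤_) (f ^ m)
  ^-supported-≥ sf zero    = weaken (λ _ → z≤n) 1ₛ-supported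
  ^-supported-≥ sf (suc m) = *-supported ℕ.+-mono-≤ sf (^-supported-≥ sf m)

  q^-supported : ∀ m → SupportedIn (_≡ m) (q ^ m)
  q^-supported zero    = 1ₛ-supported
  q^-supported (suc m) = *-supported (cong₂ ℕ._+_) q-supported (q^-supported m)
    where
    q-supported : SupportedIn (_≡ 1) q
    q-supported 0             = inj₂ refl
    q-supported 1             = inj₁ refl
    q-supported (suc (suc n)) = inj₂ refl

  module _ {P : ℕ → Set} (P-0 : P 0) (P-+ : ∀ {a b} → P a → P b → P (a ℕ.+ b)) where

    1-supported : SupportedIn P 1ₛ
    1-supported = weaken (λ { refl → P-0 }) 1ₛ-supported

    ^-supported : ∀ {f} → SupportedIn P f → ∀ m → SupportedIn P (f ^ m)
    ^-supported sf zero    = 1-supported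
    ^-supported sf (suc m) = *-supported P-+ sf (^-supported sf m)

    product-supported : ∀ {n} {f : Fin n → Series} →
                        (∀ a → SupportedIn P (f a)) → SupportedIn P (product f)
    product-supported {zero}  sf = 1-supported
    product-supported {suc n} sf =
      *-supported P-+ (sf zero) (product-supported (sf ∘ suc))

    -- As `P` is a submonoid of ℕ, the series supported in it form a subring. Coefficient `n` of the
    -- infinite product is by definition one of a finite product, so no limit is involved.
    ∞-product-supported : ∀ {a b} → SupportedIn P a → SupportedIn P b →
                          SupportedIn P ⟨ a ⨾ b ⟩∞
    ∞-product-supported sa sb n = product-supported {suc n}
      (λ m → +-supported 1-supported
               (neg-supported (*-supported P-+ sa (^-supported sb (toℕ m))))) n

  supported⇒≈0 : ∀ {N f} → SupportedIn (N ≤_) f → f ≈[ N ] 0ₛ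
  supported⇒≈0 sf .at j j<N with sf j
  ... | inj₁ N≤j = contradiction N≤j (ℕ.<⇒≱ j<N)
  ... | inj₂ f≡0 = ≡₄-reflexive f≡0

  -- Without constant term, `f` is divisible by q, hence `f ^ m` by q^m. The stability of all
  -- truncations below rests on this.
  ^≈0 : ∀ {f} → f 0 ≡ 0ℤ → ∀ {N m} → N ≤ m → f ^ m ≈[ N ] 0ₛ
  ^≈0 {f} f0 {m = m} N≤m = supported⇒≈0 (weaken {f = f ^ m} (ℕ.≤-trans N≤m)
    (^-supported-≥ {f} (λ { zero → inj₂ f0 ; (suc _) → inj₁ (s≤s z≤n) }) m))

  -- Infinite products and inverses

  -- Both `⟨_⨾_⟩∞` and `_⁻¹` read coefficient `n` off the partial product or sum with `suc n` terms.
  -- This replaces that moving truncation by the single truncation `P N`.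
  diagonal≈ : (P : ℕ → Series) → (∀ {n m} → n ≤ m → P (suc m) ≈[ n ] P m) →
              ∀ N → (λ n → P (suc n) n) ≈[ N ] P N
  diagonal≈ P stable N .at j j<N = go (ℕ.≤⇒≤′ j<N)
    where
    go : ∀ {N} → suc j ≤′ N → P (suc j) j ≡₄ P N j
    go ≤′-refl           = ≡₄-reflexive {P (suc j) j} refl
    go (≤′-step {m} j<m) = ≡₄-trans (go j<m)
      -- Stability is applied at precision `suc j`, the least that includes coefficient `j`.
      (≡₄-sym {P (suc m) j} (stable (ℕ.≤′⇒≤ j<m) .at j ℕ.≤-refl))

  -- As q^m divides `b ^ m`, the factor with index `m` is 1 modulo q^m and does not affect lower
  -- coefficients.
  ∞-product≈ : ∀ a b → b 0 ≡ 0ℤ → ∀ N →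
               ⟨ a ⨾ b ⟩∞ ≈[ N ] product {N} (λ m → 1ₛ - a * b ^ toℕ m)
  ∞-product≈ a b b0 = diagonal≈ (λ n → product {n} (λ m → F (toℕ m))) stable
    where
    F : ℕ → Series
    F m = 1ₛ - a * b ^ m
    stable : ∀ {n m} → n ≤ m →
             product {suc m} (λ i → F (toℕ i)) ≈[ n ] product {m} (λ i → F (toℕ i))
    stable {n} {m} n≤m = begin
      product {suc m} (λ i → F (toℕ i)) ≈⟨ sum-snoc *-monoid F m ⟩
      Pₘ * (1ₛ - a * b ^ m)  ≈⟨ *-congˡ {Pₘ} (+-congˡ {1ₛ} (-‿cong {a * b ^ m}
                                  (trans′ (*-congˡ {a} (^≈0 b0 n≤m)) (zeroʳ a)))) ⟩
      Pₘ * (1ₛ - 0ₛ)         ≈⟨ *-congˡ {Pₘ} (≗⇒≈ (λ { zero → refl ; (suc _) → refl })) ⟩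
      Pₘ * 1ₛ                ≈⟨ *-identityʳ Pₘ ⟩
      Pₘ                     ∎
      where
      open CommutativeRing (truncatedRing n)
        using (setoid; *-monoid; *-congˡ; +-congˡ; -‿cong; zeroʳ; *-identityʳ)
        renaming (trans to trans′)
      open import Relation.Binary.Reasoning.Setoid setoid
      Pₘ = product {m} (λ i → F (toℕ i))

  1-f+f≈1 : ∀ {N} f → (1ₛ - f) + f ≈[ N ] 1ₛ
  1-f+f≈1 f = ≗⇒≈ (λ j → eq (1ₛ j) (f j))
    where
    eq : ∀ x y → (x ℤ.- y) ℤ.+ y ≡ x
    eq = ℤSolver.solve-∀

  -- The error term `f ^ N` of the finite geometric sum is 0 modulo q^N.
  geometric≈ : ∀ {f g} → f 0 ≡ 0ℤ → ∀ N → g + f ≈[ N ] 1ₛ →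
               g * sumₛ {N} (λ m → f ^ toℕ m) ≈[ N ] 1ₛ
  geometric≈ {f} {g} f0 N g+f≈1 = begin
    g * G            ≈⟨ +-identityʳ (g * G) ⟨
    g * G + 0ₛ       ≈⟨ +-congˡ {g * G} (^≈0 {f} f0 (ℕ.≤-refl {N})) ⟨
    g * G + f ^ N    ≈⟨ +-cong (*-congˡ {g} (sum-cong-≋ {N} (λ m → reflexive (^≡^ᴿ f (toℕ m)))))
                               (reflexive (^≡^ᴿ f N)) ⟩
    g * Gᴿ + f ^ᴿ N  ≈⟨ SemiringIdentities.geometric-sum commutativeSemiring {f} {g} g+f≈1 N ⟩
    1ₛ               ∎
    where
    open CommutativeRing (truncatedRing N)
      using (setoid; semiring; commutativeSemiring; +-cong; +-congˡ; *-congˡ;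
             +-identityʳ; reflexive)
    open import Relation.Binary.Reasoning.Setoid setoid
    open import Algebra.Properties.Semiring.Exp semiring using () renaming (_^_ to _^ᴿ_)
    open import Algebra.Properties.Semiring.Sum semiring using (sum-cong-≋)
    G = sumₛ {N} (λ m → f ^ toℕ m)
    Gᴿ = sumₛ {N} (λ m → f ^ᴿ toℕ m)

  -- The inverse is the geometric series in `X = 1ₛ - f`, whose constant term is 0.
  *-inverse≈ : ∀ f → f 0 ≡ 1ℤ → ∀ N → f * f ⁻¹ ≈[ N ] 1ₛ
  *-inverse≈ f f0 N = begin
    f * f ⁻¹
      ≈⟨ *-congˡ {f} (diagonal≈ (λ n → sumₛ {n} (λ m → X ^ toℕ m)) stable N) ⟩
    f * sumₛ {N} (λ m → X ^ toℕ m)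
      ≈⟨ geometric≈ {X} {f} X0 N (≗⇒≈ (λ j → eq (f j) (1ₛ j))) ⟩
    1ₛ ∎
    where
    open CommutativeRing (truncatedRing N) using (setoid; *-congˡ)
    open import Relation.Binary.Reasoning.Setoid setoid
    X = 1ₛ - f
    X0 : X 0 ≡ 0ℤ
    X0 = cong (λ x → 1ℤ ℤ.- x) f0
    eq : ∀ x y → x ℤ.+ (y ℤ.- x) ≡ y
    eq = ℤSolver.solve-∀
    stable : ∀ {n m} → n ≤ m →
             sumₛ {suc m} (λ i → X ^ toℕ i) ≈[ n ] sumₛ {m} (λ i → X ^ toℕ i)
    stable {n} {m} n≤m = R.trans (sum-snoc R.+-monoid (X ^_) m)
      (R.trans (R.+-congˡ {G} (^≈0 {X} X0 n≤m)) (R.+-identityʳ G))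
      where
      module R = CommutativeRing (truncatedRing n)
      G = sumₛ {m} (λ i → X ^ toℕ i)

  -- The overpartition series modulo 4

  -- A partial sum of Jacobi's theta series, the sum of q^(n²) over all integers n. The omitted
  -- exponents are at least (N + 1)², so the coefficients below `N` are final.
  theta : ℕ → Series
  theta N = 1ₛ + (E + E)
    where E = sumₛ {N} (λ a → q ^ (suc (toℕ a) ℕ.* suc (toℕ a)))

  module _ (N : ℕ) where

    open CommutativeRing (truncatedRing N)
      using (setoid; semiring; ring; commutativeSemiring; *-commutativeMonoid;
             +-cong; +-congˡ; *-cong; *-congˡ; -‿cong; reflexive)
      renaming (trans to ≈-trans; sym to ≈-sym)
    open import Relation.Binary.Reasoning.Setoid setoid
    open import Algebra.Properties.Ring ring using (-‿distribˡ-*; -‿involutive)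
    open import Algebra.Properties.Semiring.Sum semiring
      using (sum-cong-≋; *-distribˡ-sum)
    open import Algebra.Properties.CommutativeMonoid.Sum *-commutativeMonoid
      using () renaming (sum-cong-≋ to product-cong; ∑-distrib-+ to product-*)
    open SemiringIdentities commutativeSemiring

    -- Each factor 1 + q^m is split as (1 - q^m)(1 + 2 Lₘ), and the factors 1 - q^m reassemble to
    -- (q)∞; division by (q)∞ is postponed.
    ⟨-q⟩∞≈⟨q⟩∞*theta : ⟨ - q ⨾ q ⟩∞ ≈[ N ] ⟨ q ⨾ q ⟩∞ * theta N
    ⟨-q⟩∞≈⟨q⟩∞*theta = begin
      ⟨ - q ⨾ q ⟩∞
        ≈⟨ ∞-product≈ (- q) q refl N ⟩
      product {N} (λ m → 1ₛ - (- q) * q ^ toℕ m)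
        ≈⟨ product-cong {N} (λ m → factor (toℕ m)) ⟩
      product {N} (λ m → y (toℕ m) * (1ₛ + (L (toℕ m) + L (toℕ m))))
        ≈⟨ product-* {N} (λ m → y (toℕ m)) (λ m → 1ₛ + (L (toℕ m) + L (toℕ m))) ⟩
      product {N} (λ m → y (toℕ m)) * product {N} (λ m → 1ₛ + (L (toℕ m) + L (toℕ m)))
        ≈⟨ *-cong (≈-sym (∞-product≈ q q refl N))
                  (product-1+2x 4≈0 {N} (λ m → L (toℕ m))) ⟩
      ⟨ q ⨾ q ⟩∞ * (1ₛ + (sumₛ {N} (λ m → L (toℕ m)) + sumₛ {N} (λ m → L (toℕ m))))
        ≈⟨ *-congˡ {⟨ q ⨾ q ⟩∞} (+-congˡ {1ₛ} (+-cong ΣL≈ ΣL≈)) ⟩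
      ⟨ q ⨾ q ⟩∞ * (1ₛ + (D + D))
        ≈⟨ *-congˡ {⟨ q ⨾ q ⟩∞} (+-congˡ {1ₛ} (2*symmetric-sum 4≈0 F F-sym N)) ⟩
      ⟨ q ⨾ q ⟩∞ * theta N ∎
      where
      -- Indices start at 0, so `x m` is q^(m+1). Modulo q^N, `G m` is 1/(1 - `x m`) and `L m` is
      -- the Lambert term `x m`/(1 - `x m`).
      x y G L : ℕ → Series
      x m = q ^ suc m
      y m = 1ₛ - x m
      G m = sumₛ {N} (λ b → x m ^ toℕ b)
      L m = x m * G m
      F : ℕ → ℕ → Series
      F a b = q ^ (suc a ℕ.* suc b)
      F-sym : ∀ a b → F a b ≈[ N ] F b a
      F-sym a b = reflexive (cong (q ^_) (ℕ.*-comm (suc a) (suc b)))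
      D = sumₛ {N} (λ a → sumₛ {N} (λ b → F (toℕ a) (toℕ b)))
      factor : ∀ m → 1ₛ - (- q) * q ^ m ≈[ N ] y m * (1ₛ + (L m + L m))
      factor m = begin
        1ₛ - (- q) * q ^ m
          ≈⟨ +-congˡ {1ₛ} (-‿cong {(- q) * q ^ m} (≈-sym (-‿distribˡ-* q (q ^ m)))) ⟩
        1ₛ + - (- (x m))          ≈⟨ +-congˡ {1ₛ} (-‿involutive (x m)) ⟩
        1ₛ + x m                  ≈⟨ 1+x≈y*[1+2*x*g] {x m} {y m} {G m} (1-f+f≈1 (x m))
                                       (geometric≈ {x m} {y m} refl N (1-f+f≈1 (x m))) ⟩
        y m * (1ₛ + (L m + L m))  ∎
      ΣL≈ : sumₛ {N} (λ m → L (toℕ m)) ≈[ N ] D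
      ΣL≈ = sum-cong-≋ {N} (λ a → ≈-trans
        (*-distribˡ-sum {N} (x (toℕ a)) (λ b → x (toℕ a) ^ toℕ b))
        -- After distribution the summand `x a * x a ^ b` is by definition `x a ^ suc b`, so both
        -- factors of the exponent start at 1.
        (sum-cong-≋ {N} (λ b → ^-assoc-≈ q (suc (toℕ a)) (suc (toℕ b)))))

    *-⟨-q⟩∞*⟨q⟩∞⁻¹ : ∀ g → ⟨ - q ⨾ q ⟩∞ * g * ⟨ q ⨾ q ⟩∞ ⁻¹ ≈[ N ] g * theta N
    *-⟨-q⟩∞*⟨q⟩∞⁻¹ =
      cancel-inverse {⟨ - q ⨾ q ⟩∞} {⟨ q ⨾ q ⟩∞} {⟨ q ⨾ q ⟩∞ ⁻¹} {theta N}
        ⟨-q⟩∞≈⟨q⟩∞*theta (*-inverse≈ ⟨ q ⨾ q ⟩∞ refl N)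

  -- Residues modulo 4 of the exponents.

  square%4≤1 : ∀ a → (a ℕ.* a) % 4 ≤ 1
  square%4≤1 a = subst (_≤ 1) (sym (%-distribˡ-* a a 4)) (go (a % 4) (m%n<n a 4))
    where
    go : ∀ r → r < 4 → (r ℕ.* r) % 4 ≤ 1
    go 0 _ = z≤n
    go 1 _ = s≤s z≤n
    go 2 _ = z≤n
    go 3 _ = s≤s z≤n
    go (suc (suc (suc (suc r)))) (s≤s (s≤s (s≤s (s≤s ()))))

  theta-supported : ∀ N → SupportedIn (λ n → n % 4 ≤ 1) (theta N)
  theta-supported N = +-supported (weaken (λ { refl → z≤n }) 1ₛ-supported)
    (+-supported squares squares)
    where
    squares : SupportedIn _ (sumₛ {N} (λ a → q ^ (suc (toℕ a) ℕ.* suc (toℕ a))))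
    squares = sum-supported {n = N} (λ a → weaken (λ { refl → square%4≤1 (suc (toℕ a)) })
                (q^-supported (suc (toℕ a) ℕ.* suc (toℕ a))))

  -- Modulo 4, `S k i` is `g` times theta. The exponents of `g` are multiples of 4 and those of
  -- theta are 0 or 1 modulo 4, so the product has no exponent with residue 2 or 3.
  S-vanishes : ∀ {k i} → 4 ∣ₙ k → 4 ∣ₙ i → ∀ n → 1 < n % 4 → (+ 4) ℤ.∣ S k i n
  S-vanishes {k} {i} 4∣k 4∣i n 1<n%4 =
    -- Precision `suc n` makes coefficient `n` visible. The congruence says that 4 divides a
    -- difference whose second term is exactly 0.
    subst ((+ 4) ℤ.∣_) (trans (cong (λ z → S k i n ℤ.- z) g*θ≡0) (ℤ.+-identityʳ (S k i n)))
      (*-⟨-q⟩∞*⟨q⟩∞⁻¹ (suc n) g .at n ℕ.≤-refl .4∣difference)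
    where
    g = ⟨ q ^ i ⨾ q ^ k ⟩∞ * ⟨ q ^ (k ∸ i) ⨾ q ^ k ⟩∞ * ⟨ q ^ k ⨾ q ^ k ⟩∞
    4∣0 : 4 ∣ₙ 0
    4∣0 = 4 ℕ.∣0
    q^-4∣ : ∀ {m} → 4 ∣ₙ m → SupportedIn (4 ∣ₙ_) (q ^ m)
    q^-4∣ {m} 4∣m = weaken (λ { refl → 4∣m }) (q^-supported m)
    ∞-4∣ : ∀ {m} → 4 ∣ₙ m → SupportedIn (4 ∣ₙ_) ⟨ q ^ m ⨾ q ^ k ⟩∞
    ∞-4∣ 4∣m = ∞-product-supported 4∣0 ℕ.∣m∣n⇒∣m+n (q^-4∣ 4∣m) (q^-4∣ 4∣k)
    4∣k∸i : 4 ∣ₙ k ∸ i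
    4∣k∸i = ℕ.divides (ℕ.quotient 4∣k ∸ ℕ.quotient 4∣i)
      (trans (cong₂ _∸_ (ℕ._∣_.equality 4∣k) (ℕ._∣_.equality 4∣i))
             (sym (ℕ.*-distribʳ-∸ 4 (ℕ.quotient 4∣k) (ℕ.quotient 4∣i))))
    g-4∣ : SupportedIn (4 ∣ₙ_) g
    g-4∣ = *-supported ℕ.∣m∣n⇒∣m+n
      (*-supported ℕ.∣m∣n⇒∣m+n (∞-4∣ 4∣i) (∞-4∣ 4∣k∸i)) (∞-4∣ 4∣k)
    add-4∣ : ∀ {a b} → 4 ∣ₙ a → b % 4 ≤ 1 → (a ℕ.+ b) % 4 ≤ 1
    add-4∣ {b = b} (ℕ.divides c refl) = subst (_≤ 1) (sym (trans
      (cong (_% 4) (ℕ.+-comm (c ℕ.* 4) b)) ([m+kn]%n≡m%n b c 4)))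
    g*θ-supported : SupportedIn (λ m → m % 4 ≤ 1) (g * theta (suc n))
    g*θ-supported = *-supported {P = 4 ∣ₙ_} {f = g} {theta (suc n)}
                      add-4∣ g-4∣ (theta-supported (suc n))
    g*θ≡0 : (g * theta (suc n)) n ≡ 0ℤ
    g*θ≡0 = Sum.[ (λ n%4≤1 → contradiction n%4≤1 (ℕ.<⇒≱ 1<n%4)) , id ]′
      (g*θ-supported n)

open import Defs using (S)
open import Data.Integer.Base using (+_)
open import Data.Integer.Divisibility using () renaming (_∣_ to _∣ℤ_)
open import Data.Nat.Base using (ℕ; _+_; _*_; _≤_)
open import Data.Nat.Divisibility using (_∣_)
open import Data.Product.Base using (_×_)

open import Data.Integer.Divisibility.Signed using (∣⇒∣ᵤ)
open import Data.Nat.Base using (_<_; _%_; s≤s; z≤n)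
open import Data.Nat.DivMod using ([m+kn]%n≡m%n)
open import Data.Nat.Properties using (+-comm; *-comm)
open import Data.Product.Base using (_,_)
open import Relation.Binary.PropositionalEquality using (_≡_; cong; subst; sym; trans)

-- Specialization to the residues 2 and 3.

[4n+r]%4≡r%4 : ∀ n r → (4 * n + r) % 4 ≡ r % 4
[4n+r]%4≡r%4 n r = trans
  (cong (_% 4) (trans (+-comm (4 * n) r) (cong (λ s → r + s) (*-comm 4 n))))
  ([m+kn]%n≡m%n r n 4)

mainTheorem7 : (k i : ℕ) → 1 ≤ i → 2 * i ≤ k → 4 ∣ k → 4 ∣ i →
    (n : ℕ) → ((+ 4) ∣ℤ S k i (4 * n + 2)) × ((+ 4) ∣ℤ S k i (4 * n + 3))
mainTheorem7 k i _ _ 4∣k 4∣i n = vanishes 2 (s≤s (s≤s z≤n)) , vanishes 3 (s≤s (s≤s z≤n))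
  where
  vanishes : ∀ r → 1 < r % 4 → (+ 4) ∣ℤ S k i (4 * n + r)
  -- The congruences use signed divisibility, with an integer quotient; the goal is divisibility of
  -- absolute values.
  vanishes r 1<r%4 = ∣⇒∣ᵤ (PowerSeries.S-vanishes 4∣k 4∣i (4 * n + r)
    (subst (1 <_) (sym ([4n+r]%4≡r%4 n r)) 1<r%4))
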